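{- For every pair $a,b$ of integers with $2\leq a\leq b$, there exists a connected graph $G$ with $\dim(G)=a$ and $\dim^+(G)=b$.
   Context: Graphs are finite and simple; $d(u,v)$ is the length of a shortest $u$-$v$ path. A vertex $w$ resolves a pair $\{x,y\}$ if $d(w,x)\neq d(w,y)$. A set $S\subseteq V(G)$ is a resolving set if every pair of vertices is resolved by some vertex of $S$. The metric dimension $\dim(G)$ is the minimum size of a resolving set. A resolving set is minimal if no proper subset of it is a resolving set; the upper dimension $\dim^+(G)$ is the maximum size of a minimal resolving set. -}

module Defs where

open import Data.Nat using (ℕ; zero; suc; _≤_)
open import Data.Bool using (Bool; true; false)
open import Data.Fin using (Fin)
open import Data.Fin.Subset using (Subset; _∈_; _⊂_; ∣_∣)
open import Data.Product using (Σ; ∃; _×_; _,_)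
open import Relation.Binary.PropositionalEquality using (_≡_; _≢_)
open import Relation.Nullary using (¬_)

record Graph : Set where
  field
    n      : ℕ
    adj    : Fin n → Fin n → Bool
    sym    : ∀ u v → adj u v ≡ adj v u
    irrefl : ∀ u → adj u u ≡ false

open Graph public

data Walk (G : Graph) : Fin (n G) → Fin (n G) → ℕ → Set where
  here : ∀ {u} → Walk G u u zero
  step : ∀ {u v w k} → adj G u v ≡ true → Walk G v w k → Walk G u w (suc k)

Connected : Graph → Set
Connected G = ∀ u v → ∃ λ k → Walk G u v k

IsDist : (G : Graph) → Fin (n G) → Fin (n G) → ℕ → Set
IsDist G u v k = Walk G u v k × (∀ m → Walk G u v m → k ≤ m)

Resolves : (G : Graph) → Fin (n G) → Fin (n G) → Fin (n G) → Set
Resolves G w x y = ∀ k l → IsDist G w x k → IsDist G w y l → k ≢ l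

IsResolving : (G : Graph) → Subset (n G) → Set
IsResolving G S = ∀ x y → x ≢ y → ∃ λ w → w ∈ S × Resolves G w x y

IsMinimalResolving : (G : Graph) → Subset (n G) → Set
IsMinimalResolving G S =
  IsResolving G S × (∀ T → T ⊂ S → ¬ IsResolving G T)

HasDim : Graph → ℕ → Set
HasDim G a =
  (∃ λ S → IsResolving G S × ∣ S ∣ ≡ a)
  × (∀ S → IsResolving G S → a ≤ ∣ S ∣)

HasUpperDim : Graph → ℕ → Set
HasUpperDim G b =
  (∃ λ S → IsMinimalResolving G S × ∣ S ∣ ≡ b)
  × (∀ S → IsMinimalResolving G S → ∣ S ∣ ≤ b)

{-# OPTIONS --safe #-}
module Submission where

-- Take a grid with P columns and Q rows of cells, and join a clique of a mutual twins to its
-- origin. A resolving set contains all twins but at most one, so only pairs of grid vertices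
-- at the same distance from the origin remain, and among these the two off-diagonal corners of
-- single cells suffice. The vertex (c , d) resolves those of the cell (x , y) iff exactly one of
-- c ≤ x and d ≤ y holds, i.e. iff the 2-colouring of columns and rows by these thresholds cuts
-- the edge xy of the complete bipartite graph K(P , Q).
--
-- The corner (0 , Q) cuts every edge, so dim = (a - 1) + 1. In a minimal resolving set every
-- element has a private edge, cut by no other element; as a cut never meets a cycle in a single
-- edge, the private edges form a forest, so dim⁺ ≤ (a - 1) + (P + Q - 1). For |P - Q| ≤ 1 the
-- inner vertices of the diagonal staircase attain this bound.

open import Defs hiding (sym; n)
open import Data.Bool using (Bool; true; false; if_then_else_)
import Data.Bool.Properties as Bool
open import Data.Fin as Fin using (Fin; zero; suc; toℕ; fromℕ; fromℕ<; inject₁; inject≤; splitAt; join; combine; remQuot; punchIn; punchOut)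
import Data.Fin.Properties as Fin
open import Data.Fin.Subset using (Subset; _∈_; _⊂_; ∣_∣; _∪_; ⁅_⁆; ⊥; inside; outside) renaming (_-_ to _∖_)
open import Data.Fin.Subset.Properties using (_∈?_; ∉⊥; x∈⁅x⁆; x∈⁅y⁆⇒x≡y; x∈p∪q⁺; x∈p∪q⁻; x∈p∧x≢y⇒x∈p-y; x∈p⇒p-x⊂p; x∈p⇒∣p-x∣<∣p∣)
open import Data.Nat using (ℕ; zero; suc; _+_; _*_; _∸_; _≤_; _<_; z≤n; s≤s; s≤s⁻¹; _≤ᵇ_; ∣_-_∣; ⌊_/2⌋; ⌈_/2⌉)
open import Data.Nat.Properties
open import Algebra.Properties.CommutativeSemigroup +-commutativeSemigroup using (interchange; x∙yz≈xz∙y; xy∙z≈x∙zy)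
open import Data.Product using (Σ; ∃; _×_; _,_; proj₁; proj₂; uncurry)
open import Data.Sum as Sum using (_⊎_; inj₁; inj₂; [_,_]′)
open import Data.Vec using (_∷_; here; there)
open import Function using (_∘_; Injective)
open import Relation.Binary.Definitions using (tri<; tri≈; tri>)
open import Relation.Binary.PropositionalEquality using (_≡_; _≢_; refl; sym; trans; cong; cong₂; subst; subst₂; ≢-sym; module ≡-Reasoning)
open import Relation.Nullary using (¬_; Dec; yes; no; does; contradiction)
open import Relation.Nullary.Decidable using (dec-true; dec-false; decidable-stable; ¬?; _×-dec_; _→-dec_)

-- Cardinality of subsets

enumerate : ∀ {n} (S : Subset n) → Fin ∣ S ∣ → Fin n
enumerate (inside  ∷ S) zero    = zero
enumerate (inside  ∷ S) (suc i) = suc (enumerate S i)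
enumerate (outside ∷ S) i       = suc (enumerate S i)

enumerate-∈ : ∀ {n} (S : Subset n) i → enumerate S i ∈ S
enumerate-∈ (inside  ∷ S) zero    = here
enumerate-∈ (inside  ∷ S) (suc i) = there (enumerate-∈ S i)
enumerate-∈ (outside ∷ S) i       = there (enumerate-∈ S i)

enumerate-injective : ∀ {n} (S : Subset n) → Injective _≡_ _≡_ (enumerate S)
enumerate-injective (inside  ∷ S) {zero}  {zero}  eq = refl
enumerate-injective (inside  ∷ S) {suc i} {suc j} eq =
  cong suc (enumerate-injective S (Fin.suc-injective eq))
enumerate-injective (outside ∷ S) eq = enumerate-injective S (Fin.suc-injective eq)

injection⇒≤∣∣ : ∀ {n} k (S : Subset n) (f : Fin k → Fin n) →
  Injective _≡_ _≡_ f → (∀ i → f i ∈ S) → k ≤ ∣ S ∣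
injection⇒≤∣∣ zero    S f inj f∈ = z≤n
injection⇒≤∣∣ (suc k) S f inj f∈ = ≤-trans
  (s≤s (injection⇒≤∣∣ k (S ∖ f zero) (f ∘ suc) (Fin.suc-injective ∘ inj)
    λ i → x∈p∧x≢y⇒x∈p-y (f∈ (suc i)) λ eq → Fin.0≢1+n (sym (inj eq))))
  (x∈p⇒∣p-x∣<∣p∣ (f∈ zero))

image : ∀ {k n} → (Fin k → Fin n) → Subset n
image {zero}  f = ⊥
image {suc k} f = ⁅ f zero ⁆ ∪ image (f ∘ suc)

∈-image⁺ : ∀ {k n} (f : Fin k → Fin n) i → f i ∈ image f
∈-image⁺ f zero    = x∈p∪q⁺ (inj₁ (x∈⁅x⁆ (f zero)))
∈-image⁺ f (suc i) = x∈p∪q⁺ (inj₂ (∈-image⁺ (f ∘ suc) i))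

∈-image⁻ : ∀ {k n} (f : Fin k → Fin n) {x} → x ∈ image f → ∃ λ i → f i ≡ x
∈-image⁻ {zero}  f x∈ = contradiction x∈ ∉⊥
∈-image⁻ {suc k} f x∈ with x∈p∪q⁻ ⁅ f zero ⁆ (image (f ∘ suc)) x∈
... | inj₁ x∈₁ = zero , sym (x∈⁅y⁆⇒x≡y (f zero) x∈₁)
... | inj₂ x∈₂ with ∈-image⁻ (f ∘ suc) x∈₂
...   | i , eq = suc i , eq

-- Both inequalities come from injections: `f` itself, and the choice of a preimage for each
-- enumerated element.
∣image∣ : ∀ {k n} (f : Fin k → Fin n) → Injective _≡_ _≡_ f → ∣ image f ∣ ≡ k
∣image∣ {k} f inj = ≤-antisym
  (Fin.injective⇒≤ {f = λ i → proj₁ (preimage i)} λ {i} {j} eq →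
    enumerate-injective (image f)
      (trans (sym (proj₂ (preimage i))) (trans (cong f eq) (proj₂ (preimage j)))))
  (injection⇒≤∣∣ k (image f) f inj (∈-image⁺ f))
  where
  preimage : ∀ i → ∃ λ j → f j ≡ enumerate (image f) i
  preimage i = ∈-image⁻ f (enumerate-∈ (image f) i)

-- The edges form a forest: contracting edge 0 is compatible with all the other
-- colourings, since none of them cuts it.
private-edges-≤ : ∀ k K (p q : Fin k → Fin (suc K)) (φ : Fin k → Fin (suc K) → Bool) →
  (∀ i → φ i (p i) ≢ φ i (q i)) →
  (∀ i j → i ≢ j → φ i (p j) ≡ φ i (q j)) →
  k ≤ K
private-edges-≤ zero    K       p q φ cut uncut = z≤n
private-edges-≤ (suc k) K       p q φ cut uncut with q zero Fin.≟ p zero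
private-edges-≤ (suc k) K       p q φ cut uncut | yes eq =
  contradiction (cong (φ zero) (sym eq)) (cut zero)
private-edges-≤ (suc k) zero    p q φ cut uncut | no q≢p with p zero | q zero
... | zero | zero = contradiction refl q≢p
private-edges-≤ (suc k) (suc K) p q φ cut uncut | no q≢p =
  s≤s (private-edges-≤ k K (contract ∘ p ∘ suc) (contract ∘ q ∘ suc)
    (λ i → φ (suc i) ∘ punchIn (q zero))
    (λ i eq → cut (suc i) (trans (sym (contract-φ i _)) (trans eq (contract-φ i _))))
    λ i j i≢j → trans (contract-φ i _)
      (trans (uncut (suc i) (suc j) (i≢j ∘ Fin.suc-injective)) (sym (contract-φ i _))))
  where
  -- The node `q zero` is deleted and everything incident to it is redirected to `p zero`.
  contract : Fin (suc (suc K)) → Fin (suc K)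
  contract x with q zero Fin.≟ x
  ... | yes _  = punchOut q≢p
  ... | no q≢x = punchOut q≢x

  contract-φ : ∀ i x → φ (suc i) (punchIn (q zero) (contract x)) ≡ φ (suc i) x
  contract-φ i x with q zero Fin.≟ x
  ... | yes refl = trans (cong (φ (suc i)) (Fin.punchIn-punchOut q≢p)) (uncut (suc i) zero λ ())
  ... | no q≢x   = cong (φ (suc i)) (Fin.punchIn-punchOut q≢x)

-- Graphs from integer metrics

-- Joining the points at distance 1 gives a graph whose path metric is `δ` again: by the triangle
-- inequality no walk is shorter than `δ`, and iterating `δ-geodesic` produces a walk of exactly
-- that length.
module MetricGraph
  {V : Set} {n : ℕ} (enc : V → Fin n) (dec : Fin n → V)
  (dec-enc : ∀ v → dec (enc v) ≡ v) (enc-dec : ∀ x → enc (dec x) ≡ x)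
  (δ : V → V → ℕ)
  (δ-refl : ∀ v → δ v v ≡ 0)
  (δ≡0⇒≡ : ∀ u v → δ u v ≡ 0 → u ≡ v)
  (δ-sym : ∀ u v → δ u v ≡ δ v u)
  (δ-triangle : ∀ u v w → δ u w ≤ δ u v + δ v w)
  (δ-geodesic : ∀ u v k → δ u v ≡ suc k → ∃ λ w → δ u w ≡ 1 × δ w v ≡ k)
  where

  dist : Fin n → Fin n → ℕ
  dist x y = δ (dec x) (dec y)

  graph : Graph
  graph = record
    { n      = n
    ; adj    = λ x y → does (dist x y ≟ 1)
    ; sym    = λ x y → cong (λ d → does (d ≟ 1)) (δ-sym (dec x) (dec y))
    ; irrefl = λ x → cong (λ d → does (d ≟ 1)) (δ-refl (dec x))
    }

  walk⇒dist≤ : ∀ {x y k} → Walk graph x y k → dist x y ≤ k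
  walk⇒dist≤ {x} here = ≤-reflexive (δ-refl (dec x))
  walk⇒dist≤ {x} {y} (step {v = z} e w) with dist x z ≟ 1
  ... | yes d≡1 = ≤-trans (δ-triangle _ (dec z) _) (+-mono-≤ (≤-reflexive d≡1) (walk⇒dist≤ w))
  ... | no d≢1  = contradiction (trans (sym e) (dec-false (_ ≟ 1) d≢1)) λ ()

  walk : ∀ k x y → dist x y ≡ k → Walk graph x y k
  walk zero x y eq = subst (λ z → Walk graph x z 0)
    (trans (sym (enc-dec x)) (trans (cong enc (δ≡0⇒≡ _ _ eq)) (enc-dec y))) here
  walk (suc k) x y eq with δ-geodesic (dec x) (dec y) k eq
  ... | w , uw , wv = step
    (dec-true (_ ≟ 1) (trans (cong (δ (dec x)) (dec-enc w)) uw))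
    (walk k (enc w) y (trans (cong (λ v → δ v (dec y)) (dec-enc w)) wv))

  connected : Connected graph
  connected x y = dist x y , walk _ x y refl

  isDist : ∀ x y → IsDist graph x y (dist x y)
  isDist x y = walk _ x y refl , λ _ → walk⇒dist≤

  isDist-unique : ∀ {x y k} → IsDist graph x y k → k ≡ dist x y
  isDist-unique {x} {y} (w , min) = ≤-antisym (min _ (walk _ x y refl)) (walk⇒dist≤ w)

  resolves⁺ : ∀ w x y → dist w x ≢ dist w y → Resolves graph w x y
  resolves⁺ w x y ≢d k l dx dy k≡l =
    ≢d (trans (sym (isDist-unique dx)) (trans k≡l (isDist-unique dy)))

  resolves⁻ : ∀ w x y → Resolves graph w x y → dist w x ≢ dist w y
  resolves⁻ w x y r = r _ _ (isDist w x) (isDist w y)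

-- Arithmetic of the grid

stepTowards : ∀ {n} (i j : Fin n) → i ≢ j →
  ∃ λ (k : Fin n) → ∣ toℕ i - toℕ k ∣ ≡ 1 × ∣ toℕ i - toℕ j ∣ ≡ suc ∣ toℕ k - toℕ j ∣
stepTowards zero zero i≢j = contradiction refl i≢j
stepTowards zero (suc zero) i≢j = suc zero , refl , refl
stepTowards zero (suc (suc j)) i≢j = suc zero , refl , refl
stepTowards (suc zero) zero i≢j = zero , refl , refl
stepTowards (suc (suc i)) zero i≢j with stepTowards (suc i) zero (λ ())
... | k , ik , kj = suc k , ik , cong suc (trans kj (cong suc (∣-∣-identityʳ (toℕ k))))
stepTowards (suc i) (suc j) i≢j with stepTowards i j (i≢j ∘ cong suc)
... | k , ik , kj = suc k , ik , kj

L1 : ℕ → ℕ → ℕ → ℕ → ℕ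
L1 a b c d = ∣ a - c ∣ + ∣ b - d ∣

L1-sym : ∀ a b c d → L1 a b c d ≡ L1 c d a b
L1-sym a b c d = cong₂ _+_ (∣-∣-comm a c) (∣-∣-comm b d)

L1-refl : ∀ a b → L1 a b a b ≡ 0
L1-refl a b = cong₂ _+_ (∣n-n∣≡0 a) (∣n-n∣≡0 b)

L1-triangle : ∀ a b c d e f → L1 a b e f ≤ L1 a b c d + L1 c d e f
L1-triangle a b c d e f = ≤-trans
  (+-mono-≤ (∣-∣-triangle a c e) (∣-∣-triangle b d f))
  (≤-reflexive (interchange ∣ a - c ∣ ∣ c - e ∣ ∣ b - d ∣ ∣ d - f ∣))

-- A unit step up from `x` leads away from `a` if `a ≤ x` and towards `a` otherwise; this threshold
-- is the source of the two colours.
a≤x⇒∣a-1+x∣ : ∀ {a x} → a ≤ x → ∣ a - suc x ∣ ≡ suc ∣ a - x ∣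
a≤x⇒∣a-1+x∣ z≤n       = refl
a≤x⇒∣a-1+x∣ (s≤s a≤x) = a≤x⇒∣a-1+x∣ a≤x

x<a⇒∣a-x∣ : ∀ {a x} → x < a → ∣ a - x ∣ ≡ suc ∣ a - suc x ∣
x<a⇒∣a-x∣ {suc a} {zero}  (s≤s z≤n) = cong suc (sym (∣-∣-identityʳ a))
x<a⇒∣a-x∣ {suc a} {suc x} (s≤s x<a) = x<a⇒∣a-x∣ x<a

a≤x⇒∣a-x+s∣ : ∀ {a x} s → a ≤ x → ∣ a - x + s ∣ ≡ ∣ a - x ∣ + s
a≤x⇒∣a-x+s∣ s z≤n       = refl
a≤x⇒∣a-x+s∣ s (s≤s a≤x) = a≤x⇒∣a-x+s∣ s a≤x

-- The first of the `suc s` unit steps approaches `a`, and each later one adds at most 1.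
x<a⇒∣a-x+s∣< : ∀ {a x} s → x < a → ∣ a - x + suc s ∣ < ∣ a - x ∣ + suc s
x<a⇒∣a-x+s∣< {suc a} {zero}  s _         = s≤s (≤-trans (∣m-n∣≤m+n a s) (+-monoʳ-≤ a (n≤1+n s)))
  where
  ∣m-n∣≤m+n : ∀ m n → ∣ m - n ∣ ≤ m + n
  ∣m-n∣≤m+n m n = ≤-trans (∣m-n∣≤m⊔n m n) (m⊔n≤m+n m n)
x<a⇒∣a-x+s∣< {suc a} {suc x} s (s≤s x<a) = x<a⇒∣a-x+s∣< s x<a

≤ᵇ-true : ∀ {m n} → m ≤ n → (m ≤ᵇ n) ≡ true
≤ᵇ-true {m} {n} m≤n = dec-true (m ≤? n) m≤n

≤ᵇ-false : ∀ {m n} → n < m → (m ≤ᵇ n) ≡ false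
≤ᵇ-false {m} {n} n<m = dec-false (m ≤? n) (<⇒≱ n<m)

cut-cases : ∀ {a x b y} → (a ≤ᵇ x) ≢ (b ≤ᵇ y) → (a ≤ x × y < b) ⊎ (x < a × b ≤ y)
cut-cases {a} {x} {b} {y} cut with ≤-<-connex a x | ≤-<-connex b y
... | inj₁ a≤x | inj₂ y<b = inj₁ (a≤x , y<b)
... | inj₂ x<a | inj₁ b≤y = inj₂ (x<a , b≤y)
... | inj₁ a≤x | inj₁ b≤y = contradiction (trans (≤ᵇ-true a≤x) (sym (≤ᵇ-true b≤y))) cut
... | inj₂ x<a | inj₂ y<b = contradiction (trans (≤ᵇ-false x<a) (sym (≤ᵇ-false y<b))) cut

cut-above : ∀ {a x b y} → a ≤ x → y < b → (a ≤ᵇ x) ≢ (b ≤ᵇ y)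
cut-above a≤x y<b eq = contradiction (trans (sym (≤ᵇ-true a≤x)) (trans eq (≤ᵇ-false y<b))) λ ()

cut-below : ∀ {a x b y} → x < a → b ≤ y → (a ≤ᵇ x) ≢ (b ≤ᵇ y)
cut-below x<a b≤y eq = cut-above b≤y x<a (sym eq)

-- The cell with lower left corner (x , y) has the two other corners
-- (x , y + 1) and (x + 1 , y) at the same distance from the origin.
¬cut⇒L1≡ : ∀ a b x y → (a ≤ᵇ x) ≡ (b ≤ᵇ y) → L1 a b x (suc y) ≡ L1 a b (suc x) y
¬cut⇒L1≡ a b x y eq with ≤-<-connex a x | ≤-<-connex b y
-- In this case both corners are one farther away than `(x , y)`, in the next one both are one
-- farther away than `(suc x , suc y)`.
... | inj₁ a≤x | inj₁ b≤y rewrite a≤x⇒∣a-1+x∣ a≤x | a≤x⇒∣a-1+x∣ b≤y = +-suc _ _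
... | inj₂ x<a | inj₂ y<b rewrite x<a⇒∣a-x∣ x<a | x<a⇒∣a-x∣ y<b = sym (+-suc _ _)
... | inj₁ a≤x | inj₂ y<b = contradiction eq (cut-above a≤x y<b)
... | inj₂ x<a | inj₁ b≤y = contradiction eq (cut-below x<a b≤y)

-- Across a square of side `suc s`, the coordinate at or above its threshold gains the full side,
-- while the other gains strictly less.
cut⇒L1≢ : ∀ a b x y s → (a ≤ᵇ x) ≢ (b ≤ᵇ y) →
  L1 a b x (y + suc s) ≢ L1 a b (x + suc s) y
cut⇒L1≢ a b x y s cut with cut-cases {a} {x} {b} {y} cut
... | inj₁ (a≤x , y<b) rewrite a≤x⇒∣a-x+s∣ (suc s) a≤x = <⇒≢ (≤-trans
  (+-monoʳ-< ∣ a - x ∣ (x<a⇒∣a-x+s∣< s y<b))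
  (≤-reflexive (x∙yz≈xz∙y ∣ a - x ∣ ∣ b - y ∣ (suc s))))
... | inj₂ (x<a , b≤y) rewrite a≤x⇒∣a-x+s∣ (suc s) b≤y = ≢-sym (<⇒≢ (≤-trans
  (+-monoˡ-< ∣ b - y ∣ (x<a⇒∣a-x+s∣< s x<a))
  (≤-reflexive (xy∙z≈x∙zy ∣ a - x ∣ (suc s) ∣ b - y ∣))))

-- The grid with twins attached to the origin

-- With `2 + p` by `2 + q` grid vertices there are P = `suc p` columns and Q = `suc q` rows of
-- cells; a is `2 + α`.
module TwinnedGrid (α p q : ℕ) where

  data V : Set where
    twin : Fin (2 + α) → V
    grid : Fin (2 + p) → Fin (2 + q) → V

  twin-injective : ∀ {i j} → twin i ≡ twin j → i ≡ j
  twin-injective refl = refl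

  order : ℕ
  order = (2 + α) + (2 + p) * (2 + q)

  enc : V → Fin order
  enc (twin i)   = join (2 + α) _ (inj₁ i)
  enc (grid c d) = join (2 + α) _ (inj₂ (combine c d))

  fromSum : Fin (2 + α) ⊎ Fin ((2 + p) * (2 + q)) → V
  fromSum (inj₁ i) = twin i
  fromSum (inj₂ y) = uncurry grid (remQuot (2 + q) y)

  dec : Fin order → V
  dec x = fromSum (splitAt (2 + α) x)

  dec-enc : ∀ v → dec (enc v) ≡ v
  dec-enc (twin i)   = cong fromSum (Fin.splitAt-join (2 + α) _ (inj₁ i))
  dec-enc (grid c d) = trans
    (cong fromSum (Fin.splitAt-join (2 + α) _ (inj₂ (combine c d))))
    (cong (uncurry grid) (Fin.remQuot-combine c d))

  enc-fromSum : ∀ s → enc (fromSum s) ≡ join (2 + α) _ s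
  enc-fromSum (inj₁ i) = refl
  enc-fromSum (inj₂ y) = cong (join (2 + α) _ ∘ inj₂) (Fin.combine-remQuot {2 + p} (2 + q) y)

  enc-dec : ∀ x → enc (dec x) ≡ x
  enc-dec x = trans (enc-fromSum (splitAt (2 + α) x)) (Fin.join-splitAt (2 + α) _ x)

  enc-injective : ∀ {u v} → enc u ≡ enc v → u ≡ v
  enc-injective {u} {v} eq = trans (sym (dec-enc u)) (trans (cong dec eq) (dec-enc v))

  -- Every shortest path from a twin into the grid enters at the origin, which is adjacent to all
  -- twins.
  δ : V → V → ℕ
  δ (twin i)   (twin j)     = if does (i Fin.≟ j) then 0 else 1
  δ (twin i)   (grid c d)   = suc (toℕ c + toℕ d)
  δ (grid c d) (twin i)     = suc (toℕ c + toℕ d)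
  δ (grid c d) (grid c′ d′) = L1 (toℕ c) (toℕ d) (toℕ c′) (toℕ d′)

  δ-refl : ∀ v → δ v v ≡ 0
  δ-refl (twin i)   = cong (if_then 0 else 1) (dec-true (i Fin.≟ i) refl)
  δ-refl (grid c d) = L1-refl (toℕ c) (toℕ d)

  δ≡0⇒≡ : ∀ u v → δ u v ≡ 0 → u ≡ v
  δ≡0⇒≡ (twin i) (twin j) eq with i Fin.≟ j
  ... | yes i≡j = cong twin i≡j
  ... | no _    = contradiction eq λ ()
  δ≡0⇒≡ (grid c d) (grid c′ d′) eq = cong₂ grid
    (Fin.toℕ-injective (∣m-n∣≡0⇒m≡n (m+n≡0⇒m≡0 ∣ toℕ c - toℕ c′ ∣ eq)))
    (Fin.toℕ-injective (∣m-n∣≡0⇒m≡n (m+n≡0⇒n≡0 ∣ toℕ c - toℕ c′ ∣ eq)))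

  δ-sym : ∀ u v → δ u v ≡ δ v u
  δ-sym (twin i) (twin j) with i Fin.≟ j
  ... | yes refl = sym (δ-refl (twin i))
  ... | no i≢j   = sym (cong (if_then 0 else 1) (dec-false (j Fin.≟ i) (≢-sym i≢j)))
  δ-sym (twin i)   (grid c d)   = refl
  δ-sym (grid c d) (twin i)     = refl
  δ-sym (grid c d) (grid c′ d′) = L1-sym (toℕ c) (toℕ d) (toℕ c′) (toℕ d′)

  δ-twins≤1 : ∀ i j → δ (twin i) (twin j) ≤ 1
  δ-twins≤1 i j with does (i Fin.≟ j)
  ... | true  = z≤n
  ... | false = ≤-refl

  δ-triangle : ∀ u v w → δ u w ≤ δ u v + δ v w
  δ-triangle (twin i) (twin j) (twin k) with i Fin.≟ j
  ... | yes refl = ≤-refl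
  ... | no _     = ≤-trans (δ-twins≤1 i k) (m≤m+n 1 _)
  δ-triangle (twin i) (twin j) (grid c d) = m≤n+m _ (δ (twin i) (twin j))
  δ-triangle (twin i) (grid c d) (twin k) = ≤-trans (δ-twins≤1 i k) (m≤m+n 1 _)
  δ-triangle (twin i) (grid c d) (grid c′ d′) =
    s≤s (L1-triangle 0 0 (toℕ c) (toℕ d) (toℕ c′) (toℕ d′))
  δ-triangle (grid c d) (twin j) (twin k) = m≤m+n _ (δ (twin j) (twin k))
  -- The detour over a twin is two longer than the one over the origin.
  δ-triangle (grid c d) (twin j) (grid c′ d′) = ≤-trans
    (L1-triangle (toℕ c) (toℕ d) 0 0 (toℕ c′) (toℕ d′))
    (+-mono-≤ (m≤n⇒m≤1+n (≤-reflexive (L1-sym (toℕ c) (toℕ d) 0 0))) (n≤1+n _))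
  δ-triangle (grid c d) (grid c′ d′) (twin k) = ≤-trans
    (s≤s (≤-trans (L1-triangle 0 0 (toℕ c′) (toℕ d′) (toℕ c) (toℕ d))
      (≤-reflexive (trans (+-comm (toℕ c′ + toℕ d′) _)
        (cong (_+ (toℕ c′ + toℕ d′)) (L1-sym (toℕ c′) (toℕ d′) (toℕ c) (toℕ d)))))))
    (≤-reflexive (sym (+-suc _ _)))
  δ-triangle (grid c d) (grid c′ d′) (grid c″ d″) =
    L1-triangle (toℕ c) (toℕ d) (toℕ c′) (toℕ d′) (toℕ c″) (toℕ d″)

  -- The next vertex is kept inside the grid so that paths towards a twin can reuse it, with the
  -- origin as target.
  grid-geodesic : ∀ c d c′ d′ k → δ (grid c d) (grid c′ d′) ≡ suc k →
    ∃ λ (w : Fin (2 + p) × Fin (2 + q)) →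
      δ (grid c d) (uncurry grid w) ≡ 1 × δ (uncurry grid w) (grid c′ d′) ≡ k
  grid-geodesic c d c′ d′ k eq with c Fin.≟ c′ | d Fin.≟ d′
  ... | yes refl | yes refl = contradiction (trans (sym (L1-refl (toℕ c) (toℕ d))) eq) λ ()
  ... | no c≢c′ | _ with stepTowards c c′ c≢c′
  ...   | e , ce , ec′ = (e , d) , cong₂ _+_ ce (∣n-n∣≡0 (toℕ d)) ,
    suc-injective (trans (cong (_+ ∣ toℕ d - toℕ d′ ∣) (sym ec′)) eq)
  grid-geodesic c d c′ d′ k eq | yes refl | no d≢d′ with stepTowards d d′ d≢d′
  ...   | e , de , ed′ = (c , e) , cong₂ _+_ (∣n-n∣≡0 (toℕ c)) de ,
    suc-injective (trans (sym (+-suc _ _)) (trans (cong (∣ toℕ c - toℕ c ∣ +_) (sym ed′)) eq))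

  δ-geodesic : ∀ u v k → δ u v ≡ suc k → ∃ λ w → δ u w ≡ 1 × δ w v ≡ k
  δ-geodesic (twin i) (twin j) k eq = twin j ,
    ≤-antisym (δ-twins≤1 i j) (≤-trans (s≤s z≤n) (≤-reflexive (sym eq))) ,
    trans (δ-refl (twin j)) (sym (n≤0⇒n≡0 (s≤s⁻¹ (≤-trans (≤-reflexive (sym eq)) (δ-twins≤1 i j)))))
  δ-geodesic (twin i) (grid c d) k eq = grid zero zero , refl , suc-injective eq
  δ-geodesic (grid c d) (twin i) zero eq = twin i , eq , δ-refl (twin i)
  δ-geodesic (grid c d) (twin i) (suc k) eq
    with grid-geodesic c d zero zero k (trans (L1-sym (toℕ c) (toℕ d) 0 0) (suc-injective eq))
  ... | (c′ , d′) , uw , wv = grid c′ d′ , uw ,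
    cong suc (trans (L1-sym 0 0 (toℕ c′) (toℕ d′)) wv)
  δ-geodesic (grid c d) (grid c′ d′) k eq with grid-geodesic c d c′ d′ k eq
  ... | w , uw , wv = uncurry grid w , uw , wv

  open MetricGraph enc dec dec-enc enc-dec δ δ-refl δ≡0⇒≡ δ-sym δ-triangle δ-geodesic public

  -- Cuts and resolving sets

  -- A node stands for a twin or for a column or row of cells. A vertex colours the nodes so
  -- that it resolves a pair of twins, or the two corners of a cell at equal distance from
  -- the origin, exactly when the corresponding nodes get different colours.
  data Node : Set where
    tw  : Fin (2 + α) → Node
    col : Fin (suc p) → Node
    row : Fin (suc q) → Node

  φ : V → Node → Bool
  φ (twin i)   (tw j)  = does (i Fin.≟ j)
  -- The colours of grid lines under a twin, and of twins under a grid vertex, are constant and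
  -- chosen so that `tw zero` and `col zero` always agree.
  φ (twin i)   (col x) = does (i Fin.≟ zero)
  φ (twin i)   (row y) = does (i Fin.≟ zero)
  φ (grid c d) (tw j)  = toℕ c ≤ᵇ 0
  φ (grid c d) (col x) = toℕ c ≤ᵇ toℕ x
  φ (grid c d) (row y) = toℕ d ≤ᵇ toℕ y

  -- The disjoint union of the complete graph on the twins and K(P , Q).
  data Edge : Set where
    twins : (i j : Fin (2 + α)) → i ≢ j → Edge
    cell  : Fin (suc p) → Fin (suc q) → Edge

  src tgt : Edge → Node
  src (twins i j _) = tw i
  src (cell x y)    = col x
  tgt (twins i j _) = tw j
  tgt (cell x y)    = row y

  Cuts : V → Edge → Set
  Cuts v e = φ v (src e) ≢ φ v (tgt e)

  Covers : Subset order → Set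
  Covers S = ∀ e → ∃ λ v → enc v ∈ S × Cuts v e

  twins-cutˡ : ∀ i j i≢j → Cuts (twin i) (twins i j i≢j)
  twins-cutˡ i j i≢j eq = contradiction
    (trans (sym (dec-true (i Fin.≟ i) refl)) (trans eq (dec-false (i Fin.≟ j) i≢j))) λ ()

  twins-cutʳ : ∀ i j i≢j → Cuts (twin j) (twins i j i≢j)
  twins-cutʳ i j i≢j eq = twins-cutˡ j i (≢-sym i≢j) (sym eq)

  cuts-twins : ∀ v i j i≢j → Cuts v (twins i j i≢j) → v ≡ twin i ⊎ v ≡ twin j
  cuts-twins (grid c d) i j i≢j cut = contradiction refl cut
  cuts-twins (twin k)   i j i≢j cut with k Fin.≟ i | k Fin.≟ j
  ... | yes k≡i | _       = inj₁ (cong twin k≡i)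
  ... | no _    | yes k≡j = inj₂ (cong twin k≡j)
  ... | no _    | no _    = contradiction refl cut

  cuts-cell : ∀ v x y → Cuts v (cell x y) →
    ∃ λ c → ∃ λ d → v ≡ grid c d × (toℕ c ≤ᵇ toℕ x) ≢ (toℕ d ≤ᵇ toℕ y)
  cuts-cell (twin k)   x y cut = contradiction refl cut
  cuts-cell (grid c d) x y cut = c , d , refl , cut

  end₁ end₂ : Edge → V
  end₁ (twins i j _) = twin i
  end₁ (cell x y)    = grid (inject₁ x) (suc y)
  end₂ (twins i j _) = twin j
  end₂ (cell x y)    = grid (suc x) (inject₁ y)

  end₁≢end₂ : ∀ e → end₁ e ≢ end₂ e
  end₁≢end₂ (twins i j i≢j) eq = i≢j (twin-injective eq)
  end₁≢end₂ (cell x y)      eq = 1+n≢n (trans (sym (cong abscissa eq)) (Fin.toℕ-inject₁ x))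
    where
    abscissa : V → ℕ
    abscissa (twin _)   = 0
    abscissa (grid c _) = toℕ c

  ¬cuts⇒δ≡ : ∀ v e → φ v (src e) ≡ φ v (tgt e) → δ v (end₁ e) ≡ δ v (end₂ e)
  ¬cuts⇒δ≡ (twin k)   (twins i j _) eq = cong (if_then 0 else 1) eq
  ¬cuts⇒δ≡ (grid c d) (twins i j _) eq = refl
  -- A twin only sees the distance to the origin, which is the same for both corners.
  ¬cuts⇒δ≡ (twin k)   (cell x y)    eq rewrite Fin.toℕ-inject₁ x | Fin.toℕ-inject₁ y =
    cong suc (+-suc (toℕ x) (toℕ y))
  ¬cuts⇒δ≡ (grid c d) (cell x y)    eq rewrite Fin.toℕ-inject₁ x | Fin.toℕ-inject₁ y =
    ¬cut⇒L1≡ (toℕ c) (toℕ d) (toℕ x) (toℕ y) eq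

  resolving⇒covers : ∀ {S} → IsResolving graph S → Covers S
  resolving⇒covers {S} res e
    with res (enc (end₁ e)) (enc (end₂ e)) (end₁≢end₂ e ∘ enc-injective)
  ... | w , w∈S , r = dec w , subst (_∈ S) (sym (enc-dec w)) w∈S , λ eq →
    resolves⁻ w _ _ r (subst₂ (λ u v → δ (dec w) u ≡ δ (dec w) v)
      (sym (dec-enc _)) (sym (dec-enc _)) (¬cuts⇒δ≡ (dec w) e eq))

  Distinguished : Subset order → V → V → Set
  Distinguished S u v = ∃ λ w → enc w ∈ S × δ w u ≢ δ w v

  distinguished-sym : ∀ {S u v} → Distinguished S u v → Distinguished S v u
  distinguished-sym (w , w∈S , ≢d) = w , w∈S , ≢-sym ≢d

  -- The cell at the lower left corner of the square spanned by the two points decides.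
  antidiagonal-distinguished : ∀ {S} → Covers S → ∀ c d c′ d′ → toℕ c < toℕ c′ →
    toℕ c + toℕ d ≡ toℕ c′ + toℕ d′ → Distinguished S (grid c d) (grid c′ d′)
  antidiagonal-distinguished C c d c′ d′ c<c′ eq with m≤n⇒∃[o]m+o≡n c<c′
  ... | s , c+s≡c′ = helper
    where
    -- The square has side `suc s`: the first coordinate rises by it and the second falls by it.
    c′≡ : toℕ c + suc s ≡ toℕ c′
    c′≡ = trans (+-suc (toℕ c) s) c+s≡c′

    d≡ : toℕ d′ + suc s ≡ toℕ d
    d≡ = +-cancelˡ-≡ (toℕ c) _ _ (begin
      toℕ c + (toℕ d′ + suc s) ≡⟨ x∙yz≈xz∙y (toℕ c) (toℕ d′) (suc s) ⟩
      toℕ c + suc s + toℕ d′   ≡⟨ cong (_+ toℕ d′) c′≡ ⟩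
      toℕ c′ + toℕ d′          ≡⟨ eq ⟨
      toℕ c + toℕ d            ∎)
      where open ≡-Reasoning

    c<P : toℕ c < suc p
    c<P = ≤-trans c<c′ (s≤s⁻¹ (Fin.toℕ<n c′))

    d′<Q : toℕ d′ < suc q
    d′<Q = ≤-trans (≤-trans (m≤m+n _ s) (≤-reflexive (trans (sym (+-suc (toℕ d′) s)) d≡)))
      (s≤s⁻¹ (Fin.toℕ<n d))

    helper : Distinguished _ (grid c d) (grid c′ d′)
    helper with C (cell (fromℕ< c<P) (fromℕ< d′<Q))
    ... | v , v∈S , cut with cuts-cell v _ _ cut
    ...   | a , b , refl , ab-cut
      rewrite Fin.toℕ-fromℕ< c<P | Fin.toℕ-fromℕ< d′<Q =
      grid a b , v∈S , λ δ≡ → cut⇒L1≢ (toℕ a) (toℕ b) (toℕ c) (toℕ d′) s ab-cut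
        (subst₂ (λ y x → L1 (toℕ a) (toℕ b) (toℕ c) y ≡ L1 (toℕ a) (toℕ b) x (toℕ d′))
          (sym d≡) (sym c′≡) δ≡)

  covers⇒twin : ∀ {S} → Covers S → ∃ λ k → enc (twin k) ∈ S
  covers⇒twin C with C (twins zero (suc zero) (λ ()))
  ... | v , v∈S , cut with cuts-twins v zero (suc zero) (λ ()) cut
  ...   | inj₁ refl = _ , v∈S
  ...   | inj₂ refl = _ , v∈S

  covers⇒grid : ∀ {S} → Covers S → ∃ λ c → ∃ λ d → enc (grid c d) ∈ S
  covers⇒grid C with C (cell zero zero)
  ... | v , v∈S , cut with cuts-cell v _ _ cut
  ...   | c , d , refl , _ = c , d , v∈S

  -- A twin in `S` fails only if `(c , d)` is the origin; then any grid vertex of `S` works, being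
  -- one farther from `twin i` than from the origin.
  twin-grid-distinguished : ∀ {S} → Covers S → ∀ i c d → Distinguished S (twin i) (grid c d)
  twin-grid-distinguished C i c d with covers⇒twin C | covers⇒grid C
  ... | k , k∈S | a , b , ab∈S with δ (twin k) (twin i) ≟ suc (toℕ c + toℕ d)
  ...   | no ≢d  = twin k , k∈S , ≢d
  ...   | yes eq = grid a b , ab∈S , λ δ≡ → 1+n≢n (trans δ≡
    (trans (cong₂ (L1 (toℕ a) (toℕ b)) c≡0 d≡0) (sym (L1-sym 0 0 (toℕ a) (toℕ b)))))
    where
    c+d≡0 : toℕ c + toℕ d ≡ 0
    c+d≡0 = n≤0⇒n≡0 (s≤s⁻¹ (≤-trans (≤-reflexive (sym eq)) (δ-twins≤1 k i)))
    c≡0 : toℕ c ≡ 0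
    c≡0 = m+n≡0⇒m≡0 (toℕ c) c+d≡0
    d≡0 : toℕ d ≡ 0
    d≡0 = m+n≡0⇒n≡0 (toℕ c) c+d≡0

  -- Two twins are separated by their own edge. Grid vertices at different distances from the origin
  -- are separated by any twin in `S`; at equal distances they lie on one antidiagonal.
  covers⇒distinguished : ∀ {S} → Covers S → ∀ u v → u ≢ v → Distinguished S u v
  covers⇒distinguished C (twin i) (twin j) u≢v with C (twins i j (u≢v ∘ cong twin))
  ... | v , v∈S , cut with cuts-twins v i j (u≢v ∘ cong twin) cut
  ...   | inj₁ refl = twin i , v∈S , λ eq → u≢v (δ≡0⇒≡ _ _ (trans (sym eq) (δ-refl (twin i))))
  ...   | inj₂ refl = twin j , v∈S , λ eq → u≢v (sym (δ≡0⇒≡ _ _ (trans eq (δ-refl (twin j)))))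
  covers⇒distinguished C (twin i)   (grid c d) u≢v = twin-grid-distinguished C i c d
  covers⇒distinguished {S} C (grid c d) (twin i) u≢v =
    distinguished-sym {S} (twin-grid-distinguished C i c d)
  covers⇒distinguished {S} C (grid c d) (grid c′ d′) u≢v
    with toℕ c + toℕ d ≟ toℕ c′ + toℕ d′
  ... | no ≢d with covers⇒twin C
  ...   | k , k∈S = twin k , k∈S , ≢d ∘ suc-injective
  covers⇒distinguished {S} C (grid c d) (grid c′ d′) u≢v | yes eq
    with <-cmp (toℕ c) (toℕ c′)
  ... | tri< c<c′ _ _ = antidiagonal-distinguished C c d c′ d′ c<c′ eq
  ... | tri> _ _ c′<c =
    distinguished-sym {S} (antidiagonal-distinguished C c′ d′ c d c′<c (sym eq))
  ... | tri≈ _ c≡c′ _ = contradiction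
    (cong₂ grid (Fin.toℕ-injective c≡c′) (Fin.toℕ-injective
      (+-cancelˡ-≡ (toℕ c) _ _ (trans eq (cong (_+ toℕ d′) (sym c≡c′)))))) u≢v

  covers⇒resolving : ∀ {S} → Covers S → IsResolving graph S
  covers⇒resolving C x y x≢y with covers⇒distinguished C (dec x) (dec y)
    (λ eq → x≢y (trans (sym (enc-dec x)) (trans (cong enc eq) (enc-dec y))))
  ... | w , w∈S , ≢d = enc w , w∈S , resolves⁺ _ x y
    (subst (λ v → δ v (dec x) ≢ δ v (dec y)) (sym (dec-enc w)) ≢d)

  -- Upper bound for the upper dimension

  Uncut : Subset order → Node → Node → Set
  Uncut S s t = ∀ x → x ∈ S → φ (dec x) s ≡ φ (dec x) t

  uncut? : ∀ S s t → Dec (Uncut S s t)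
  uncut? S s t = Fin.all? λ x → (x ∈? S) →-dec (φ (dec x) s Bool.≟ φ (dec x) t)

  ¬uncut⇒cut : ∀ {S s t} → ¬ Uncut S s t → ∃ λ v → enc v ∈ S × φ v s ≢ φ v t
  ¬uncut⇒cut {S} {s} {t} ¬u
    with Fin.any? (λ x → (x ∈? S) ×-dec ¬? (φ (dec x) s Bool.≟ φ (dec x) t))
  ... | yes (x , x∈S , cut) = dec x , subst (_∈ S) (sym (enc-dec x)) x∈S , cut
  ... | no none = contradiction
    (λ x x∈S → decidable-stable (_ Bool.≟ _) λ cut → none (x , x∈S , cut)) ¬u

  -- Being uncut is decidable, so a finite search over all edges turns the negation into a witness.
  ¬covers⇒uncut : ∀ {S} → ¬ Covers S → ∃ λ e → Uncut S (src e) (tgt e)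
  ¬covers⇒uncut {S} ¬C
    with Fin.any? (λ i → Fin.any? λ j → ¬? (i Fin.≟ j) ×-dec uncut? S (tw i) (tw j))
       | Fin.any? (λ x → Fin.any? λ y → uncut? S (col x) (row y))
  ... | yes (i , j , i≢j , u) | _               = twins i j i≢j , u
  ... | no _                  | yes (x , y , u) = cell x y , u
  ... | no allTwins           | no allCells     = contradiction covers ¬C
    where
    covers : Covers S
    covers (twins i j i≢j) = ¬uncut⇒cut λ u → allTwins (i , j , i≢j , u)
    covers (cell x y)      = ¬uncut⇒cut λ u → allCells (x , y , u)

  -- Some element of `S` cuts `e`, and only `x` is left to do it.
  uncut-without⇒cuts : ∀ {S} → Covers S → ∀ x e → Uncut (S ∖ x) (src e) (tgt e) → Cuts (dec x) e
  uncut-without⇒cuts C x e u with C e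
  ... | v , v∈S , v-cut with enc v Fin.≟ x
  ...   | yes refl = subst (λ w → Cuts w e) (sym (dec-enc v)) v-cut
  ...   | no v≢x   = contradiction
    (subst (λ w → φ w (src e) ≡ φ w (tgt e)) (dec-enc v)
      (u (enc v) (x∈p∧x≢y⇒x∈p-y v∈S v≢x))) v-cut

  encN : Node → Fin ((2 + α) + (suc p + suc q))
  encN (tw i)  = join (2 + α) _ (inj₁ i)
  encN (col x) = join (2 + α) _ (inj₂ (join (suc p) _ (inj₁ x)))
  encN (row y) = join (2 + α) _ (inj₂ (join (suc p) _ (inj₂ y)))

  decN : Fin ((2 + α) + (suc p + suc q)) → Node
  decN z = [ tw , (λ z′ → [ col , row ]′ (splitAt (suc p) z′)) ]′ (splitAt (2 + α) z)

  decN-encN : ∀ z → decN (encN z) ≡ z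
  decN-encN (tw i) rewrite Fin.splitAt-join (2 + α) (suc p + suc q) (inj₁ i) = refl
  decN-encN (col x)
    rewrite Fin.splitAt-join (2 + α) (suc p + suc q) (inj₂ (join (suc p) (suc q) (inj₁ x)))
          | Fin.splitAt-join (suc p) (suc q) (inj₁ x) = refl
  decN-encN (row y)
    rewrite Fin.splitAt-join (2 + α) (suc p + suc q) (inj₂ (join (suc p) (suc q) (inj₂ y)))
          | Fin.splitAt-join (suc p) (suc q) (inj₂ y) = refl

  -- The private edges, together with one bridge between twins and grid lines, form a forest on all
  -- `(2 + α) + (suc p + suc q)` nodes. The bridge accounts for the second component and so improves
  -- the bound by one.
  minimal⇒≤ : ∀ S → IsMinimalResolving graph S → ∣ S ∣ ≤ (2 + α) + (p + q)
  minimal⇒≤ S (res , minimal) = ≤-trans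
    (s≤s⁻¹ (private-edges-≤ (suc ∣ S ∣) _ (encN ∘ source) (encN ∘ target)
      (λ i → colour i ∘ decN) cut uncut))
    (≤-reflexive rearrange)
    where
    rearrange : α + (suc p + suc q) ≡ (2 + α) + (p + q)
    rearrange = begin
      α + suc (p + suc q)   ≡⟨ +-suc α (p + suc q) ⟩
      suc (α + (p + suc q)) ≡⟨ cong (λ z → suc (α + z)) (+-suc p q) ⟩
      suc (α + suc (p + q)) ≡⟨ cong suc (+-suc α (p + q)) ⟩
      (2 + α) + (p + q)     ∎
      where open ≡-Reasoning

    s : Fin ∣ S ∣ → Fin order
    s = enumerate S

    private-edge : ∀ i → ∃ λ e → Uncut (S ∖ s i) (src e) (tgt e)
    private-edge i = ¬covers⇒uncut
      (minimal (S ∖ s i) (x∈p⇒p-x⊂p (enumerate-∈ S i)) ∘ covers⇒resolving)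

    edge : Fin ∣ S ∣ → Edge
    edge = proj₁ ∘ private-edge

    edge-cut : ∀ i → Cuts (dec (s i)) (edge i)
    edge-cut i = uncut-without⇒cuts (resolving⇒covers res) (s i) (edge i) (proj₂ (private-edge i))

    isTwin : Node → Bool
    isTwin (tw _)  = true
    isTwin (col _) = false
    isTwin (row _) = false

    -- Edge 0 joins the two components formed by the twins and by the grid lines.
    source target : Fin (suc ∣ S ∣) → Node
    source zero    = tw zero
    source (suc i) = src (edge i)
    target zero    = col zero
    target (suc i) = tgt (edge i)

    colour : Fin (suc ∣ S ∣) → Node → Bool
    colour zero    = isTwin
    colour (suc i) = φ (dec (s i))

    colour-cut : ∀ i → colour i (source i) ≢ colour i (target i)
    colour-cut zero    ()
    colour-cut (suc i) = edge-cut i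

    isTwin-edge : ∀ e → isTwin (src e) ≡ isTwin (tgt e)
    isTwin-edge (twins _ _ _) = refl
    isTwin-edge (cell _ _)    = refl

    φ-bridge : ∀ v → φ v (tw zero) ≡ φ v (col zero)
    φ-bridge (twin _)   = refl
    φ-bridge (grid _ _) = refl

    -- No private edge leaves its component, so `isTwin` cuts none of them; the defaults in `φ` keep
    -- the bridge uncut by every vertex.
    colour-uncut : ∀ i j → i ≢ j → colour i (source j) ≡ colour i (target j)
    colour-uncut zero    zero    i≢j = contradiction refl i≢j
    colour-uncut zero    (suc j) i≢j = isTwin-edge (edge j)
    colour-uncut (suc i) zero    i≢j = φ-bridge (dec (s i))
    colour-uncut (suc i) (suc j) i≢j = proj₂ (private-edge j) (s i)
      (x∈p∧x≢y⇒x∈p-y (enumerate-∈ S i) (i≢j ∘ cong suc ∘ enumerate-injective S))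

    decoded : ∀ i z → colour i (decN (encN z)) ≡ colour i z
    decoded i z = cong (colour i) (decN-encN z)

    cut : ∀ i → colour i (decN (encN (source i))) ≢ colour i (decN (encN (target i)))
    cut i eq = colour-cut i (trans (sym (decoded i _)) (trans eq (decoded i _)))

    uncut : ∀ i j → i ≢ j → colour i (decN (encN (source j))) ≡ colour i (decN (encN (target j)))
    uncut i j i≢j = trans (decoded i _) (trans (colour-uncut i j i≢j) (sym (decoded i _)))

  -- The metric dimension

  image-covers : ∀ {k} (f : Fin k → V) → (∀ e → ∃ λ i → Cuts (f i) e) → Covers (image (enc ∘ f))
  image-covers f cov e with cov e
  ... | i , cut = f i , ∈-image⁺ (enc ∘ f) i , cut

  -- Two missing twins would leave their edge uncut, so at most one is missing; a grid vertex of `S`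
  -- takes its place in the injection.
  covers⇒≥ : ∀ S → Covers S → 2 + α ≤ ∣ S ∣
  covers⇒≥ S C with covers⇒grid C
  ... | c , d , cd∈S = injection⇒≤∣∣ (2 + α) S f f-injective f∈S
    where
    f : Fin (2 + α) → Fin order
    f i = if does (enc (twin i) ∈? S) then enc (twin i) else enc (grid c d)

    f∈S : ∀ i → f i ∈ S
    f∈S i with enc (twin i) ∈? S
    ... | yes i∈S = i∈S
    ... | no _    = cd∈S

    f-injective : Injective _≡_ _≡_ f
    f-injective {i} {j} eq with enc (twin i) ∈? S | enc (twin j) ∈? S
    ... | yes _ | yes _ = twin-injective (enc-injective eq)
    ... | yes _ | no _  = contradiction (enc-injective {twin i} {grid c d} eq) λ ()
    ... | no _  | yes _ = contradiction (enc-injective {grid c d} {twin j} eq) λ ()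
    ... | no i∉S | no j∉S = decidable-stable (i Fin.≟ j) bothMissing
      where
      bothMissing : ¬ (i ≢ j)
      bothMissing i≢j with C (twins i j i≢j)
      ... | v , v∈S , cut with cuts-twins v i j i≢j cut
      ...   | inj₁ refl = i∉S v∈S
      ...   | inj₂ refl = j∉S v∈S

  hasDim : HasDim graph (2 + α)
  hasDim = (image (enc ∘ f) , covers⇒resolving (image-covers f f-covers)
             , ∣image∣ (enc ∘ f) (f-injective ∘ enc-injective))
         , λ S res → covers⇒≥ S (resolving⇒covers res)
    where
    f : Fin (2 + α) → V
    -- The corner `(0 , Q)`: 0 is at most every column index and `suc q` exceeds every row index, so
    -- all cells are cut.
    f zero    = grid zero (fromℕ (suc q))
    f (suc i) = twin (suc i)

    f-injective : Injective _≡_ _≡_ f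
    f-injective {zero}  {zero}  eq = refl
    f-injective {suc i} {suc j} eq = twin-injective eq

    f-covers : ∀ e → ∃ λ i → Cuts (f i) e
    f-covers (twins (suc i) j i≢j)       = suc i , twins-cutˡ (suc i) j i≢j
    f-covers (twins zero (suc j) i≢j)    = suc j , twins-cutʳ zero (suc j) i≢j
    f-covers (twins zero zero i≢j)       = contradiction refl i≢j
    f-covers (cell x y) = zero , cut-above {x = toℕ x} z≤n
      (≤-trans (Fin.toℕ<n y) (s≤s (≤-reflexive (sym (Fin.toℕ-fromℕ q)))))

  -- A minimal resolving set attaining the bound

  module _ (p≤q : p ≤ q) (q≤1+p : q ≤ suc p) where

    -- All twins but one, then the P + Q - 1 edges of a path that alternates between rows and
    -- columns; it can visit all of them because P ≤ Q ≤ P + 1.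
    Index : Set
    Index = Fin (suc α) ⊎ (Fin (suc p) ⊎ Fin q)

    -- The grid vertices cut exactly one edge each of the path row 0, col 0, row 1, col 1, ...
    g : Index → V
    g (inj₁ i)        = twin (suc i)
    g (inj₂ (inj₁ k)) = grid (inject₁ k) (suc (inject≤ k (s≤s p≤q)))
    g (inj₂ (inj₂ k)) = grid (suc (inject≤ k q≤1+p)) (suc (inject₁ k))

    privateEdge : Index → Edge
    privateEdge (inj₁ i)        = twins zero (suc i) λ ()
    privateEdge (inj₂ (inj₁ k)) = cell k (inject≤ k (s≤s p≤q))
    privateEdge (inj₂ (inj₂ k)) = cell (inject≤ k q≤1+p) (suc k)

    privateEdge-cut : ∀ i → Cuts (g i) (privateEdge i)
    privateEdge-cut (inj₁ i) = twins-cutʳ zero (suc i) λ ()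
    privateEdge-cut (inj₂ (inj₁ k)) =
      cut-above {y = toℕ (inject≤ k (s≤s p≤q))} (≤-reflexive (Fin.toℕ-inject₁ k)) ≤-refl
    privateEdge-cut (inj₂ (inj₂ k)) =
      cut-below {x = toℕ (inject≤ k q≤1+p)} ≤-refl (s≤s (≤-reflexive (Fin.toℕ-inject₁ k)))

    -- Along the path a grid vertex of the family colours an initial segment `false` and the rest
    -- `true`, so the colour switches only at its own edge. The twin edges form a star around
    -- `twin zero`, which is left out.
    privateEdge-uncut : ∀ i j → Cuts (g j) (privateEdge i) → j ≡ i
    privateEdge-uncut (inj₁ i) (inj₁ j) cut
      with cuts-twins (twin (suc j)) zero (suc i) (λ ()) cut
    ... | inj₂ refl = refl
    privateEdge-uncut (inj₁ i) (inj₂ (inj₁ l)) cut = contradiction refl cut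
    privateEdge-uncut (inj₁ i) (inj₂ (inj₂ l)) cut = contradiction refl cut
    privateEdge-uncut (inj₂ (inj₁ k)) (inj₁ j) cut = contradiction refl cut
    privateEdge-uncut (inj₂ (inj₂ k)) (inj₁ j) cut = contradiction refl cut
    privateEdge-uncut (inj₂ (inj₁ k)) (inj₂ (inj₁ l)) cut
      rewrite Fin.toℕ-inject₁ l | Fin.toℕ-inject≤ l (s≤s p≤q) | Fin.toℕ-inject≤ k (s≤s p≤q)
      with cut-cases {toℕ l} {toℕ k} cut
    ... | inj₁ (l≤k , k<1+l) = cong (inj₂ ∘ inj₁) (Fin.toℕ-injective (≤-antisym l≤k (s≤s⁻¹ k<1+l)))
    ... | inj₂ (k<l , l<k)   = contradiction l<k (<-asym k<l)
    privateEdge-uncut (inj₂ (inj₁ k)) (inj₂ (inj₂ l)) cut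
      rewrite Fin.toℕ-inject₁ l | Fin.toℕ-inject≤ l q≤1+p | Fin.toℕ-inject≤ k (s≤s p≤q) =
      contradiction refl cut
    privateEdge-uncut (inj₂ (inj₂ k)) (inj₂ (inj₁ l)) cut
      rewrite Fin.toℕ-inject₁ l | Fin.toℕ-inject≤ l (s≤s p≤q) | Fin.toℕ-inject≤ k q≤1+p
      with cut-cases {toℕ l} {toℕ k} {suc (toℕ l)} {suc (toℕ k)} cut
    ... | inj₁ (l≤k , k<l) = contradiction (s≤s⁻¹ k<l) (≤⇒≯ l≤k)
    ... | inj₂ (k<l , l≤k) = contradiction k<l (≤⇒≯ (s≤s⁻¹ l≤k))
    privateEdge-uncut (inj₂ (inj₂ k)) (inj₂ (inj₂ l)) cut
      rewrite Fin.toℕ-inject₁ l | Fin.toℕ-inject≤ l q≤1+p | Fin.toℕ-inject≤ k q≤1+p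
      with cut-cases {suc (toℕ l)} {toℕ k} {suc (toℕ l)} {suc (toℕ k)} cut
    ... | inj₁ (l<k , k<l) = contradiction (s≤s⁻¹ k<l) (<-asym l<k)
    ... | inj₂ (k<1+l , l≤k) = cong (inj₂ ∘ inj₂)
      (Fin.toℕ-injective (≤-antisym (s≤s⁻¹ l≤k) (s≤s⁻¹ k<1+l)))

    g-injective : ∀ {i j} → g i ≡ g j → i ≡ j
    g-injective {i} {j} eq =
      privateEdge-uncut j i (subst (λ v → Cuts v (privateEdge j)) (sym eq) (privateEdge-cut j))

    g-covers : ∀ e → ∃ λ i → Cuts (g i) e
    g-covers (twins (suc i) j i≢j)    = inj₁ i , twins-cutˡ (suc i) j i≢j
    g-covers (twins zero (suc j) i≢j) = inj₁ j , twins-cutʳ zero (suc j) i≢j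
    g-covers (twins zero zero i≢j)    = contradiction refl i≢j
    g-covers (cell x y) with ≤-<-connex (toℕ y) (toℕ x)
    -- For `y ≤ x` the vertex `(y , y + 1)` cuts the cell, and for `x < y` the vertex
    -- `(x + 1 , x + 1)` does.
    ... | inj₁ y≤x = inj₂ (inj₁ k) , cut-above
        (≤-trans (≤-reflexive (trans (Fin.toℕ-inject₁ k) (Fin.toℕ-fromℕ< y<P))) y≤x)
        (s≤s (≤-reflexive (sym (trans (Fin.toℕ-inject≤ k _) (Fin.toℕ-fromℕ< y<P)))))
      where
      y<P : toℕ y < suc p
      y<P = ≤-trans (s≤s y≤x) (Fin.toℕ<n x)
      k : Fin (suc p)
      k = fromℕ< y<P
    ... | inj₂ x<y = inj₂ (inj₂ k) , cut-below
        (s≤s (≤-reflexive (sym (trans (Fin.toℕ-inject≤ k _) (Fin.toℕ-fromℕ< x<q)))))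
        (≤-trans (s≤s (≤-reflexive (trans (Fin.toℕ-inject₁ k) (Fin.toℕ-fromℕ< x<q)))) x<y)
      where
      x<q : toℕ x < q
      x<q = ≤-trans x<y (s≤s⁻¹ (Fin.toℕ<n y))
      k : Fin q
      k = fromℕ< x<q

    index : Fin (suc α + (suc p + q)) → Index
    index z = Sum.map₂ (splitAt (suc p)) (splitAt (suc α) z)

    position : Index → Fin (suc α + (suc p + q))
    position i = join (suc α) _ (Sum.map₂ (join (suc p) q) i)

    position-index : ∀ z → position (index z) ≡ z
    position-index z = trans (cong (join (suc α) _) (unsplit (splitAt (suc α) z)))
      (Fin.join-splitAt (suc α) _ z)
      where
      unsplit : ∀ s → Sum.map₂ (join (suc p) q) (Sum.map₂ (splitAt (suc p)) s) ≡ s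
      unsplit (inj₁ _) = refl
      unsplit (inj₂ y) = cong inj₂ (Fin.join-splitAt (suc p) q y)

    index-position : ∀ i → index (position i) ≡ i
    index-position i = trans
      (cong (Sum.map₂ (splitAt (suc p))) (Fin.splitAt-join (suc α) _ (Sum.map₂ (join (suc p) q) i)))
      (unjoin i)
      where
      unjoin : ∀ i → Sum.map₂ (splitAt (suc p)) (Sum.map₂ (join (suc p) q) i) ≡ i
      unjoin (inj₁ _) = refl
      unjoin (inj₂ y) = cong inj₂ (Fin.splitAt-join (suc p) q y)

    hasUpperDim : HasUpperDim graph ((2 + α) + (p + q))
    hasUpperDim = (S , (covers⇒resolving S-covers , S-minimal) , ∣S∣) , minimal⇒≤
      where
      f : Fin (suc α + (suc p + q)) → V
      f = g ∘ index

      S : Subset order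
      S = image (enc ∘ f)

      f-covers : ∀ e → ∃ λ z → Cuts (f z) e
      f-covers e with g-covers e
      ... | i , cut = position i , subst (λ j → Cuts (g j) e) (sym (index-position i)) cut

      S-covers : Covers S
      S-covers = image-covers f f-covers

      f-injective : Injective _≡_ _≡_ f
      f-injective {y} {z} eq = trans (sym (position-index y))
        (trans (cong position (g-injective eq)) (position-index z))

      ∣S∣ : ∣ S ∣ ≡ (2 + α) + (p + q)
      ∣S∣ = trans (∣image∣ (enc ∘ f) (f-injective ∘ enc-injective)) (+-suc (suc α) (p + q))

      S-minimal : ∀ T → T ⊂ S → ¬ IsResolving graph T
      S-minimal T (T⊆S , x , x∈S , x∉T) res with ∈-image⁻ (enc ∘ f) x∈S
      -- The private edge of the omitted vertex must still be cut by some `v` in `T`; since `T` lies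
      -- in `S`, that `v` is the omitted vertex itself.
      ... | z , refl with resolving⇒covers res (privateEdge (index z))
      ...   | v , v∈T , cut with ∈-image⁻ (enc ∘ f) (T⊆S v∈T)
      ...     | y , eq = x∉T (subst (_∈ T) (trans (sym eq) (cong (enc ∘ g) same)) v∈T)
        where
        same : index y ≡ index z
        same = privateEdge-uncut (index z) (index y)
          (subst (λ w → Cuts w (privateEdge (index z))) (sym (enc-injective {f y} {v} eq)) cut)

-- Choice of the grid size

⌈n/2⌉≤1+⌊n/2⌋ : ∀ n → ⌈ n /2⌉ ≤ suc ⌊ n /2⌋
⌈n/2⌉≤1+⌊n/2⌋ zero          = z≤n
⌈n/2⌉≤1+⌊n/2⌋ (suc zero)    = s≤s z≤n
⌈n/2⌉≤1+⌊n/2⌋ (suc (suc n)) = s≤s (⌈n/2⌉≤1+⌊n/2⌋ n)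

theorem3p5 : (a b : ℕ) → 2 ≤ a → a ≤ b →
    Σ Graph (λ G → Connected G × HasDim G a × HasUpperDim G b)
theorem3p5 (suc (suc α)) b (s≤s (s≤s z≤n)) a≤b =
  graph , connected , hasDim ,
  subst (HasUpperDim graph)
    (trans (cong (2 + α +_) (⌊n/2⌋+⌈n/2⌉≡n r)) (m+[n∸m]≡n a≤b))
    (hasUpperDim (⌊n/2⌋≤⌈n/2⌉ r) (⌈n/2⌉≤1+⌊n/2⌋ r))
  where
  -- The excess b - a is halved between `p` and `q`, so that `p ≤ q ≤ suc p` and a + (p + q) is b.
  r : ℕ
  r = b ∸ (2 + α)
  open TwinnedGrid α ⌊ r /2⌋ ⌈ r /2⌉
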